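{- Let $k$ be a positive integer. Then (i) $\rho_{k,1}(2)=2^{k-1}$; (ii) $\rho_{k,1}(4) = 4^{k-1}+2^{\frac{3 k}{2}-1} \sin \left(\frac{\pi k}{4}\right)$; (iii) $\rho_{k,3}(4) = 4^{k-1}-2^{\frac{3 k}{2}-1} \sin \left(\frac{\pi k}{4}\right)$; (iv) $\rho_{k,1}(8)= 2^{2 k-3} \left(2^k+2^{\frac{k}{2}+1} \sin \left(\frac{\pi k}{4}\right)+2 \sin \left(\frac{\pi(k+1)}{4} \right)-2 \cos \left(\frac{ \pi (3k+1)}{4}\right)\right)$; (v) $\rho_{k,3}(8)=2^{2 k-3} \left(2^k-2^{\frac{k}{2}+1} \sin \left(\frac{\pi k}{4}\right)-2 \left(\cos \left(\frac{ \pi (k+1)}{4}\right)+\cos \left(\frac{3 \pi (k+1)}{4}\right)\right)\right)$; (vi) $\rho_{k,5}(8)=2^{2 k-3} \left(2^k+2^{\frac{k}{2}+1} \sin \left(\frac{\pi k}{4}\right)-2 \sin \left(\frac{ \pi (k+1)}{4}\right)+2 \cos \left(\frac{\pi (3k+1)}{4}\right)\right)$; (vii) $\rho_{k,7}(8)= 2^{2 k-3} \left(2^k-2^{\frac{k}{2}+1} \sin \left(\frac{\pi k}{4}\right)-2 \sin \left(\frac{3 \pi k+\pi}{4}\right)+2 \cos \left(\frac{ \pi (k+1)}{4}\right)\right)$.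
   Context: For positive integers $k,n$ and an integer $\lambda$, $\rho_{k,\lambda}(n)$ denotes the number of $k$-tuples $(x_1,\ldots,x_k)\in(\mathbb{Z}/n\mathbb{Z})^k$ with $x_1^2+\cdots+x_k^2\equiv\lambda\pmod n$. -}

module Defs where

open import Data.Nat as ℕ using (ℕ; zero; suc; NonZero)
open import Data.Integer as ℤ using (ℤ; +_; _%ℕ_)
open import Data.Rational as ℚ using (ℚ; 0ℚ; 1ℚ)
open import Data.Fin using (Fin; toℕ)
open import Data.Vec using (Vec; []; _∷_)
open import Data.List using (List; [_]; concatMap; map; filter; length; allFin)
open import Relation.Nullary using (Dec)

allVecs : (n k : ℕ) → List (Vec (Fin n) k)
allVecs n zero = [ [] ]
allVecs n (suc k) = concatMap (λ i → map (i ∷_) (allVecs n k)) (allFin n)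

sumSq : ∀ {n k} → Vec (Fin n) k → ℕ
sumSq [] = 0
sumSq (x ∷ xs) = toℕ x ℕ.* toℕ x ℕ.+ sumSq xs

ρ : (k : ℕ) → (lam : ℤ) → (n : ℕ) → .{{_ : NonZero n}} → ℕ
ρ k lam n = length (filter (λ v → (+ sumSq v) %ℕ n ℕ.≟ lam %ℕ n) (allVecs n k))

-- The field ℚ(√2): a + b√2 with a b ∈ ℚ.  Since 1, √2 are ℚ-linearly
-- independent, equality of such numbers is equality of both coordinates.
record Q√2 : Set where
  constructor _+_√2
  field
    re : ℚ
    ir : ℚ
open Q√2 public

infixl 6 _⊕_ _⊖_
infixl 7 _⊗_

_⊕_ : Q√2 → Q√2 → Q√2
(a + b √2) ⊕ (c + d √2) = (a ℚ.+ c) + (b ℚ.+ d) √2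

neg : Q√2 → Q√2
neg (a + b √2) = (ℚ.- a) + (ℚ.- b) √2

_⊖_ : Q√2 → Q√2 → Q√2
x ⊖ y = x ⊕ neg y

_⊗_ : Q√2 → Q√2 → Q√2
(a + b √2) ⊗ (c + d √2) =
  (a ℚ.* c ℚ.+ (+ 2 ℚ./ 1) ℚ.* (b ℚ.* d)) + (a ℚ.* d ℚ.+ b ℚ.* c) √2

ofℚ : ℚ → Q√2
ofℚ q = q + 0ℚ √2

ofℕ : ℕ → Q√2
ofℕ n = ofℚ (+ n ℚ./ 1)

√2 : Q√2
√2 = 0ℚ + 1ℚ √2

√2^ : ℕ → Q√2
√2^ zero = ofℚ 1ℚ
√2^ (suc m) = √2 ⊗ √2^ m

-- exact values sin(π m / 4) and cos(π m / 4), m ∈ ℕ, by m mod 8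
-- (√2/2 = 0 + ½ √2)
private
  h : Q√2
  h = 0ℚ + ℚ.½ √2
  one : Q√2
  one = ofℚ 1ℚ
  zer : Q√2
  zer = ofℚ 0ℚ

sinTable : ℕ → Q√2
sinTable 0 = zer
sinTable 1 = h
sinTable 2 = one
sinTable 3 = h
sinTable 4 = zer
sinTable 5 = neg h
sinTable 6 = neg one
sinTable _ = neg h

cosTable : ℕ → Q√2
cosTable 0 = one
cosTable 1 = h
cosTable 2 = zer
cosTable 3 = neg h
cosTable 4 = neg one
cosTable 5 = neg h
cosTable 6 = zer
cosTable _ = h

sinπ/4 : ℕ → Q√2
sinπ/4 m = sinTable (m ℕ.% 8)

cosπ/4 : ℕ → Q√2
cosπ/4 m = cosTable (m ℕ.% 8)

{-# OPTIONS --safe #-}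
module Submission where

-- Splitting off the
-- first coordinate gives the linear recurrence
--   count n (k+1) r = Σ_{i,t ∈ ℤ/nℤ} [i² + t ≡ r] · count n k t.
-- For n = 2, 4, 8 the Gauss sums predict that count n k r is a polynomial in √2^k whose coefficients
-- depend only on r and on k mod 8.  Such a formula is proved by induction on k: by linearity the
-- induction step reduces to finitely many identities between coefficients (one for each k mod 8,
-- r and degree), which are verified by computation in ℚ(√2), as is the case k = 1.  The seven
-- formulas of the statement are these closed forms at odd r, rewritten with the identities
-- cos(θ + π/2) = -sin θ, cos(θ + π) = -cos θ and cos(θ + 3π/2) = sin θ.

open import Algebra.Bundles using (CommutativeRing; CommutativeSemiring)
open import Data.Bool using (Bool; true; false; if_then_else_)
open import Data.Fin using (Fin; zero; suc; toℕ; #_)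
open import Data.Fin.Properties using (all?; toℕ-fromℕ<; toℕ<n)
open import Data.List using (List; []; _∷_; _++_; map; concatMap; tabulate; allFin; filter; length)
open import Data.Nat as ℕ using (ℕ; zero; suc; NonZero; _%_; _≡ᵇ_)
open import Data.Nat.DivMod using (_mod_; m%n<n; m%n%n≡m%n; m<n⇒m%n≡m; %-distribˡ-+; %-distribˡ-*)
open import Data.Vec using (Vec; _∷_)
open import Function using (_∘_; id)
open import Relation.Binary.PropositionalEquality as ≡ using (_≡_)
open import Defs

%-cong-+ˡ : ∀ a {m n d} .{{_ : NonZero d}} → m % d ≡ n % d → (a ℕ.+ m) % d ≡ (a ℕ.+ n) % d
%-cong-+ˡ a {m} {n} {d} m≡n = begin
  (a ℕ.+ m) % d            ≡⟨ %-distribˡ-+ a m d ⟩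
  (a % d ℕ.+ m % d) % d    ≡⟨ ≡.cong (λ x → (a % d ℕ.+ x) % d) m≡n ⟩
  (a % d ℕ.+ n % d) % d    ≡⟨ %-distribˡ-+ a n d ⟨
  (a ℕ.+ n) % d            ∎
  where open ≡.≡-Reasoning

%-cong-*ˡ : ∀ a {m n d} .{{_ : NonZero d}} → m % d ≡ n % d → (a ℕ.* m) % d ≡ (a ℕ.* n) % d
%-cong-*ˡ a {m} {n} {d} m≡n = begin
  (a ℕ.* m) % d            ≡⟨ %-distribˡ-* a m d ⟩
  (a % d ℕ.* (m % d)) % d  ≡⟨ ≡.cong (λ x → (a % d ℕ.* x) % d) m≡n ⟩
  (a % d ℕ.* (n % d)) % d  ≡⟨ %-distribˡ-* a n d ⟨
  (a ℕ.* n) % d            ∎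
  where open ≡.≡-Reasoning

toℕ-mod : ∀ m n .{{_ : NonZero n}} → toℕ (m mod n) ≡ m % n
toℕ-mod m n = toℕ-fromℕ< (m%n<n m n)

toℕ-mod-% : ∀ m n .{{_ : NonZero n}} → toℕ (m mod n) % n ≡ m % n
toℕ-mod-% m n = ≡.trans (≡.cong (_% n) (toℕ-mod m n)) (m%n%n≡m%n m n)

module SumsOfSquares {c ℓ} (R : CommutativeSemiring c ℓ) where

  open CommutativeSemiring R hiding (zero)
  open import Algebra.Properties.Semiring.Sum semiring
  open import Algebra.Properties.CommutativeSemiring.Exp R using (_^_; ^-distrib-*)
  open import Relation.Binary.Reasoning.Setoid setoid

  ⟦_⟧ : Bool → Carrier
  ⟦ b ⟧ = if b then 1# else 0#

  ∑ˡ : ∀ {a} {A : Set a} → List A → (A → Carrier) → Carrier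
  ∑ˡ []       f = 0#
  ∑ˡ (x ∷ xs) f = f x + ∑ˡ xs f

  module _ {a} {A : Set a} where

    ∑ˡ-cong : ∀ (xs : List A) {f g} → (∀ x → f x ≈ g x) → ∑ˡ xs f ≈ ∑ˡ xs g
    ∑ˡ-cong []       f≈g = refl
    ∑ˡ-cong (x ∷ xs) f≈g = +-cong (f≈g x) (∑ˡ-cong xs f≈g)

    ∑ˡ-++ : ∀ (xs ys : List A) f → ∑ˡ (xs ++ ys) f ≈ ∑ˡ xs f + ∑ˡ ys f
    ∑ˡ-++ []       ys f = sym (+-identityˡ _)
    ∑ˡ-++ (x ∷ xs) ys f = trans (+-congˡ (∑ˡ-++ xs ys f)) (sym (+-assoc _ _ _))

    ∑ˡ-map : ∀ {b} {B : Set b} (g : B → A) xs f → ∑ˡ (map g xs) f ≡ ∑ˡ xs (f ∘ g)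
    ∑ˡ-map g []       f = ≡.refl
    ∑ˡ-map g (x ∷ xs) f = ≡.cong (f (g x) +_) (∑ˡ-map g xs f)

    ∑ˡ-tabulate : ∀ {n} (g : Fin n → A) f → ∑ˡ (tabulate g) f ≡ ∑[ i < n ] f (g i)
    ∑ˡ-tabulate {zero}  g f = ≡.refl
    ∑ˡ-tabulate {suc n} g f = ≡.cong (f (g zero) +_) (∑ˡ-tabulate (g ∘ suc) f)

    ∑ˡ-concatMap : ∀ {b} {B : Set b} (g : B → List A) is f →
                   ∑ˡ (concatMap g is) f ≈ ∑ˡ is (λ i → ∑ˡ (g i) f)
    ∑ˡ-concatMap g []       f = refl
    ∑ˡ-concatMap g (i ∷ is) f = trans (∑ˡ-++ (g i) _ f) (+-congˡ (∑ˡ-concatMap g is f))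

    ∑ˡ-∑-comm : ∀ {n} (xs : List A) (f : A → Fin n → Carrier) →
                ∑ˡ xs (λ x → ∑[ t < n ] f x t) ≈ ∑[ t < n ] ∑ˡ xs (λ x → f x t)
    ∑ˡ-∑-comm {n} []       f = sym (sum-replicate-zero n)
    ∑ˡ-∑-comm     (x ∷ xs) f = trans (+-congˡ (∑ˡ-∑-comm xs f)) (sym (∑-distrib-+ (f x) _))

    *-distribʳ-∑ˡ : ∀ (xs : List A) f y → ∑ˡ xs (λ x → f x * y) ≈ ∑ˡ xs f * y
    *-distribʳ-∑ˡ []       f y = sym (zeroˡ y)
    *-distribʳ-∑ˡ (x ∷ xs) f y = trans (+-congˡ (*-distribʳ-∑ˡ xs f y)) (sym (distribʳ y (f x) _))

  ∑ˡ-allVecs-suc : ∀ n k (f : Vec (Fin n) (suc k) → Carrier) →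
    ∑ˡ (allVecs n (suc k)) f ≈ ∑[ i < n ] ∑ˡ (allVecs n k) (λ v → f (i ∷ v))
  ∑ˡ-allVecs-suc n k f = begin
    ∑ˡ (concatMap (λ i → map (i ∷_) (allVecs n k)) (allFin n)) f
      ≈⟨ ∑ˡ-concatMap _ (allFin n) f ⟩
    ∑ˡ (allFin n) (λ i → ∑ˡ (map (i ∷_) (allVecs n k)) f)
      ≡⟨ ∑ˡ-tabulate {n = n} id _ ⟩
    ∑[ i < n ] ∑ˡ (map (i ∷_) (allVecs n k)) f
      ≡⟨ sum-cong-≗ {n} (λ i → ∑ˡ-map (i ∷_) (allVecs n k) f) ⟩
    ∑[ i < n ] ∑ˡ (allVecs n k) (λ v → f (i ∷ v)) ∎

  ∑-δ : ∀ {n} (g : Fin n → Carrier) i → ∑[ t < n ] (⟦ toℕ i ≡ᵇ toℕ t ⟧ * g t) ≈ g i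
  ∑-δ {suc n} g zero = begin
    1# * g zero + ∑[ t < n ] (0# * g (suc t)) ≈⟨ +-cong (*-identityˡ _) (sum-cong-≋ {n} (λ t → zeroˡ _)) ⟩
    g zero + ∑[ t < n ] 0#                   ≈⟨ +-congˡ (sum-replicate-zero n) ⟩
    g zero + 0#                              ≈⟨ +-identityʳ _ ⟩
    g zero                                   ∎
  ∑-δ {suc n} g (suc i) = begin
    0# * g zero + ∑[ t < n ] (⟦ toℕ i ≡ᵇ toℕ t ⟧ * g (suc t)) ≈⟨ +-cong (zeroˡ _) (∑-δ (g ∘ suc) i) ⟩
    0# + g (suc i)                                            ≈⟨ +-identityˡ _ ⟩
    g (suc i)                                                 ∎

  poly : ℕ → (ℕ → Carrier) → Carrier → Carrier
  poly D a x = ∑[ d < D ] (a (toℕ d) * x ^ toℕ d)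

  poly-scale : ∀ D (a : ℕ → Carrier) y x → poly D (λ d → a d * y ^ d) x ≈ poly D a (y * x)
  poly-scale D a y x = sum-cong-≋ {D} λ d → begin
    a (toℕ d) * y ^ toℕ d * x ^ toℕ d    ≈⟨ *-assoc _ _ _ ⟩
    a (toℕ d) * (y ^ toℕ d * x ^ toℕ d)  ≈⟨ *-congˡ (^-distrib-* y x (toℕ d)) ⟨
    a (toℕ d) * (y * x) ^ toℕ d          ∎

  module _ (n : ℕ) .{{_ : NonZero n}} where

    ∑ˡ-fibres : ∀ {a} {A : Set a} (s : A → ℕ) (g : ℕ → Carrier) xs →
      ∑ˡ xs (λ x → g (s x % n)) ≈ ∑[ t < n ] (∑ˡ xs (λ x → ⟦ s x % n ≡ᵇ toℕ t ⟧) * g (toℕ t))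
    ∑ˡ-fibres s g xs = begin
      ∑ˡ xs (λ x → g (s x % n))
        ≈⟨ ∑ˡ-cong xs (λ x → sym (fibre (s x))) ⟩
      ∑ˡ xs (λ x → ∑[ t < n ] (⟦ s x % n ≡ᵇ toℕ t ⟧ * g (toℕ t)))
        ≈⟨ ∑ˡ-∑-comm {n = n} xs _ ⟩
      ∑[ t < n ] ∑ˡ xs (λ x → ⟦ s x % n ≡ᵇ toℕ t ⟧ * g (toℕ t))
        ≈⟨ sum-cong-≋ {n} (λ t → *-distribʳ-∑ˡ xs _ (g (toℕ t))) ⟩
      ∑[ t < n ] (∑ˡ xs (λ x → ⟦ s x % n ≡ᵇ toℕ t ⟧) * g (toℕ t)) ∎
      where
      fibre : ∀ m → ∑[ t < n ] (⟦ m % n ≡ᵇ toℕ t ⟧ * g (toℕ t)) ≈ g (m % n)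
      fibre m = ≡.subst (λ j → ∑[ t < n ] (⟦ j ≡ᵇ toℕ t ⟧ * g (toℕ t)) ≈ g j)
                        (toℕ-mod m n) (∑-δ (g ∘ toℕ) (m mod n))

    count : ℕ → ℕ → Carrier
    count k r = ∑ˡ (allVecs n k) (λ v → ⟦ sumSq v % n ≡ᵇ r ⟧)

    addSquare : (ℕ → Carrier) → ℕ → Carrier
    addSquare f r = ∑[ i < n ] ∑[ t < n ] (⟦ (toℕ i ℕ.* toℕ i ℕ.+ toℕ t) % n ≡ᵇ r ⟧ * f (toℕ t))

    count-suc : ∀ k r → count (suc k) r ≈ addSquare (count k) r
    count-suc k r = begin
      count (suc k) r
        ≈⟨ ∑ˡ-allVecs-suc n k _ ⟩
      ∑[ i < n ] ∑ˡ (allVecs n k) (λ v → ⟦ (toℕ i ℕ.* toℕ i ℕ.+ sumSq v) % n ≡ᵇ r ⟧)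
        ≈⟨ sum-cong-≋ {n} (λ i → ∑ˡ-cong (allVecs n k) (λ v → reflexive (≡.cong (λ m → ⟦ m ≡ᵇ r ⟧)
             (%-cong-+ˡ (toℕ i ℕ.* toℕ i) (≡.sym (m%n%n≡m%n (sumSq v) n)))))) ⟩
      ∑[ i < n ] ∑ˡ (allVecs n k) (λ v → ⟦ (toℕ i ℕ.* toℕ i ℕ.+ sumSq v % n) % n ≡ᵇ r ⟧)
        ≈⟨ sum-cong-≋ {n} (λ i → ∑ˡ-fibres sumSq (λ m → ⟦ (toℕ i ℕ.* toℕ i ℕ.+ m) % n ≡ᵇ r ⟧) (allVecs n k)) ⟩
      ∑[ i < n ] ∑[ t < n ] (count k (toℕ t) * ⟦ (toℕ i ℕ.* toℕ i ℕ.+ toℕ t) % n ≡ᵇ r ⟧)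
        ≈⟨ sum-cong-≋ {n} (λ i → sum-cong-≋ {n} (λ t → *-comm _ _)) ⟩
      addSquare (count k) r ∎

    addSquare-cong : ∀ {f g} → (∀ (t : Fin n) → f (toℕ t) ≈ g (toℕ t)) → ∀ r → addSquare f r ≈ addSquare g r
    addSquare-cong f≈g r = sum-cong-≋ {n} (λ i → sum-cong-≋ {n} (λ t → *-congˡ (f≈g t)))

    count≈closedForm : (F : ℕ → ℕ → Carrier) →
      (∀ (r : Fin n) → count 1 (toℕ r) ≈ F 1 (toℕ r)) →
      (∀ k (r : Fin n) → addSquare (F k) (toℕ r) ≈ F (suc k) (toℕ r)) →
      ∀ k (r : Fin n) → count (suc k) (toℕ r) ≈ F (suc k) (toℕ r)
    count≈closedForm F base step zero    r = base r
    count≈closedForm F base step (suc k) r = begin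
      count (suc (suc k)) (toℕ r)        ≈⟨ count-suc (suc k) (toℕ r) ⟩
      addSquare (count (suc k)) (toℕ r)  ≈⟨ addSquare-cong {count (suc k)} {F (suc k)}
                                              (count≈closedForm F base step k) (toℕ r) ⟩
      addSquare (F (suc k)) (toℕ r)      ≈⟨ step (suc k) r ⟩
      F (suc (suc k)) (toℕ r)            ∎

    addSquare-poly : ∀ D (a : ℕ → ℕ → Carrier) x r →
      addSquare (λ t → poly D (a t) x) r ≈ poly D (λ d → addSquare (λ t → a t d) r) x
    addSquare-poly D a x r = begin
      ∑[ i < n ] ∑[ t < n ] (I i t * ∑[ d < D ] (a (toℕ t) (toℕ d) * x ^ toℕ d))
        ≈⟨ sum-cong-≋ {n} (λ i → sum-cong-≋ {n} (λ t →
             *-distribˡ-sum {D} (I i t) (λ d → a (toℕ t) (toℕ d) * x ^ toℕ d))) ⟩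
      ∑[ i < n ] ∑[ t < n ] ∑[ d < D ] (I i t * (a (toℕ t) (toℕ d) * x ^ toℕ d))
        ≈⟨ sum-cong-≋ {n} (λ i → sum-cong-≋ {n} (λ t → sum-cong-≋ {D} (λ d → sym (*-assoc _ _ _)))) ⟩
      ∑[ i < n ] ∑[ t < n ] ∑[ d < D ] (I i t * a (toℕ t) (toℕ d) * x ^ toℕ d)
        ≈⟨ sum-cong-≋ {n} (λ i → ∑-comm {n} {D} _) ⟩
      ∑[ i < n ] ∑[ d < D ] ∑[ t < n ] (I i t * a (toℕ t) (toℕ d) * x ^ toℕ d)
        ≈⟨ ∑-comm {n} {D} _ ⟩
      ∑[ d < D ] ∑[ i < n ] ∑[ t < n ] (I i t * a (toℕ t) (toℕ d) * x ^ toℕ d)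
        ≈⟨ sum-cong-≋ {D} (λ d → sym (∑∑-*ʳ (λ i t → I i t * a (toℕ t) (toℕ d)) (x ^ toℕ d))) ⟩
      ∑[ d < D ] (addSquare (λ t → a t (toℕ d)) r * x ^ toℕ d) ∎
      where
      I : Fin n → Fin n → Carrier
      I i t = ⟦ (toℕ i ℕ.* toℕ i ℕ.+ toℕ t) % n ≡ᵇ r ⟧
      ∑∑-*ʳ : ∀ (f : Fin n → Fin n → Carrier) y →
              (∑[ i < n ] ∑[ t < n ] f i t) * y ≈ ∑[ i < n ] ∑[ t < n ] (f i t * y)
      ∑∑-*ʳ f y = trans (*-distribʳ-sum {n} y _) (sum-cong-≋ {n} (λ i → *-distribʳ-sum y (f i)))

    addSquare-poly-step : ∀ {D} (c : ℕ → ℕ → ℕ → Carrier) y k r →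
      (∀ (d : Fin D) → addSquare (λ t → c k t (toℕ d)) r ≈ c (suc k) r (toℕ d) * y ^ toℕ d) →
      addSquare (λ t → poly D (c k t) (y ^ k)) r ≈ poly D (c (suc k) r) (y ^ suc k)
    addSquare-poly-step {D} c y k r step = begin
      addSquare (λ t → poly D (c k t) (y ^ k)) r          ≈⟨ addSquare-poly D (c k) (y ^ k) r ⟩
      poly D (λ d → addSquare (λ t → c k t d) r) (y ^ k)  ≈⟨ sum-cong-≋ {D} (λ d → *-congʳ {(y ^ k) ^ toℕ d} (step d)) ⟩
      poly D (λ d → c (suc k) r d * y ^ d) (y ^ k)        ≈⟨ poly-scale D (c (suc k) r) y (y ^ k) ⟩
      poly D (c (suc k) r) (y ^ suc k)                    ∎

open ≡ using (refl; sym; trans; cong; cong₂; module ≡-Reasoning)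

open import Algebra.Structures {A = Q√2} _≡_ using (IsCommutativeRing)
import Algebra.Solver.Ring.AlmostCommutativeRing as ACR
import Algebra.Solver.Ring.Simple as RingSolver
open import Data.Integer as ℤ using (+_)
import Data.Integer.Properties as ℤ
import Data.Nat.Coprimality as Coprimality
import Data.Nat.Properties as ℕ
open import Data.Product using (_×_; _,_)
open import Data.Rational as ℚ using (0ℚ; 1ℚ; _/_; ½)
import Data.Rational.Properties as ℚ
open import Data.Rational.Solver using (module +-*-Solver)
open import Data.Rational.Unnormalised using (mkℚᵘ; *≡*)
open import Level using (0ℓ)
open import Relation.Nullary using (Dec; yes; no; does)
open import Relation.Nullary.Decidable using (True; toWitness)
import Relation.Unary as U

⊕-assoc : ∀ x y z → (x ⊕ y) ⊕ z ≡ x ⊕ (y ⊕ z)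
⊕-assoc (a + b √2) (c + d √2) (e + f √2) = cong₂ _+_√2 (ℚ.+-assoc a c e) (ℚ.+-assoc b d f)

⊕-comm : ∀ x y → x ⊕ y ≡ y ⊕ x
⊕-comm (a + b √2) (c + d √2) = cong₂ _+_√2 (ℚ.+-comm a c) (ℚ.+-comm b d)

⊕-identityˡ : ∀ x → ofℚ 0ℚ ⊕ x ≡ x
⊕-identityˡ (a + b √2) = cong₂ _+_√2 (ℚ.+-identityˡ a) (ℚ.+-identityˡ b)

⊕-identityʳ : ∀ x → x ⊕ ofℚ 0ℚ ≡ x
⊕-identityʳ (a + b √2) = cong₂ _+_√2 (ℚ.+-identityʳ a) (ℚ.+-identityʳ b)

neg-inverseˡ : ∀ x → neg x ⊕ x ≡ ofℚ 0ℚ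
neg-inverseˡ (a + b √2) = cong₂ _+_√2 (ℚ.+-inverseˡ a) (ℚ.+-inverseˡ b)

neg-inverseʳ : ∀ x → x ⊕ neg x ≡ ofℚ 0ℚ
neg-inverseʳ (a + b √2) = cong₂ _+_√2 (ℚ.+-inverseʳ a) (ℚ.+-inverseʳ b)

⊗-assoc : ∀ x y z → (x ⊗ y) ⊗ z ≡ x ⊗ (y ⊗ z)
⊗-assoc (a + b √2) (c + d √2) (e + f √2) = cong₂ _+_√2
  (solve 6 (λ a b c d e f →
      (a :* c :+ two :* (b :* d)) :* e :+ two :* ((a :* d :+ b :* c) :* f)
    := a :* (c :* e :+ two :* (d :* f)) :+ two :* (b :* (c :* f :+ d :* e))) refl a b c d e f)
  (solve 6 (λ a b c d e f →
      (a :* c :+ two :* (b :* d)) :* f :+ (a :* d :+ b :* c) :* e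
    := a :* (c :* f :+ d :* e) :+ b :* (c :* e :+ two :* (d :* f))) refl a b c d e f)
  where
  open +-*-Solver
  two = con (+ 2 / 1)

⊗-comm : ∀ x y → x ⊗ y ≡ y ⊗ x
⊗-comm (a + b √2) (c + d √2) = cong₂ _+_√2
  (solve 4 (λ a b c d → a :* c :+ two :* (b :* d) := c :* a :+ two :* (d :* b)) refl a b c d)
  (solve 4 (λ a b c d → a :* d :+ b :* c := c :* b :+ d :* a) refl a b c d)
  where
  open +-*-Solver
  two = con (+ 2 / 1)

⊗-identityˡ : ∀ x → ofℚ 1ℚ ⊗ x ≡ x
⊗-identityˡ (a + b √2) = cong₂ _+_√2
  (solve 2 (λ a b → con 1ℚ :* a :+ con (+ 2 / 1) :* (con 0ℚ :* b) := a) refl a b)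
  (solve 2 (λ a b → con 1ℚ :* b :+ con 0ℚ :* a := b) refl a b)
  where open +-*-Solver

⊗-identityʳ : ∀ x → x ⊗ ofℚ 1ℚ ≡ x
⊗-identityʳ x = trans (⊗-comm x _) (⊗-identityˡ x)

⊗-distribʳ-⊕ : ∀ x y z → (y ⊕ z) ⊗ x ≡ y ⊗ x ⊕ z ⊗ x
⊗-distribʳ-⊕ (a + b √2) (c + d √2) (e + f √2) = cong₂ _+_√2
  (solve 6 (λ a b c d e f → (c :+ e) :* a :+ two :* ((d :+ f) :* b)
     := (c :* a :+ two :* (d :* b)) :+ (e :* a :+ two :* (f :* b))) refl a b c d e f)
  (solve 6 (λ a b c d e f → (c :+ e) :* b :+ (d :+ f) :* a
     := (c :* b :+ d :* a) :+ (e :* b :+ f :* a)) refl a b c d e f)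
  where
  open +-*-Solver
  two = con (+ 2 / 1)

⊗-distribˡ-⊕ : ∀ x y z → x ⊗ (y ⊕ z) ≡ x ⊗ y ⊕ x ⊗ z
⊗-distribˡ-⊕ x y z = begin
  x ⊗ (y ⊕ z)        ≡⟨ ⊗-comm x _ ⟩
  (y ⊕ z) ⊗ x        ≡⟨ ⊗-distribʳ-⊕ x y z ⟩
  y ⊗ x ⊕ z ⊗ x      ≡⟨ cong₂ _⊕_ (⊗-comm y x) (⊗-comm z x) ⟩
  x ⊗ y ⊕ x ⊗ z      ∎
  where open ≡-Reasoning

Q√2-isCommutativeRing : IsCommutativeRing _⊕_ _⊗_ neg (ofℚ 0ℚ) (ofℚ 1ℚ)
Q√2-isCommutativeRing = record
  { isRing = record
    { +-isAbelianGroup = record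
      { isGroup = record
        { isMonoid = record
          { isSemigroup = record
            { isMagma = record { isEquivalence = ≡.isEquivalence ; ∙-cong = cong₂ _⊕_ }
            ; assoc = ⊕-assoc }
          ; identity = ⊕-identityˡ , ⊕-identityʳ }
        ; inverse = neg-inverseˡ , neg-inverseʳ
        ; ⁻¹-cong = cong neg }
      ; comm = ⊕-comm }
    ; *-cong = cong₂ _⊗_
    ; *-assoc = ⊗-assoc
    ; *-identity = ⊗-identityˡ , ⊗-identityʳ
    ; distrib = ⊗-distribˡ-⊕ , ⊗-distribʳ-⊕ }
  ; *-comm = ⊗-comm }

Q√2-commutativeRing : CommutativeRing 0ℓ 0ℓ
Q√2-commutativeRing = record { isCommutativeRing = Q√2-isCommutativeRing }

infix 4 _≟_
_≟_ : (x y : Q√2) → Dec (x ≡ y)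
(a + b √2) ≟ (c + d √2) with a ℚ.≟ c | b ℚ.≟ d
... | yes refl | yes refl = yes refl
... | no a≢c   | _        = no λ { refl → a≢c refl }
... | yes _    | no b≢d   = no λ { refl → b≢d refl }

open CommutativeRing Q√2-commutativeRing using (commutativeSemiring; ring; semiring; 0#; 1#)
open import Algebra.Properties.CommutativeSemiring.Exp commutativeSemiring
  using (^-assocʳ) renaming (_^_ to _↑_)
open import Algebra.Properties.Ring ring using (-‿distribʳ-*)
import Algebra.Properties.Semiring.Mult semiring as Mult
open RingSolver (ACR.fromCommutativeRing Q√2-commutativeRing) _≟_
  using (solve; _:=_; con; _:+_; _:*_; _:^_; :-_; _:-_)
open SumsOfSquares commutativeSemiring

cong₃ : ∀ {A B C D : Set} (f : A → B → C → D) {a a′ b b′ c c′} →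
        a ≡ a′ → b ≡ b′ → c ≡ c′ → f a b c ≡ f a′ b′ c′
cong₃ f refl refl refl = refl

ofℕ-suc : ∀ m → ofℕ (suc m) ≡ 1# ⊕ ofℕ m
ofℕ-suc m = cong₂ _+_√2 (sym (begin
  1ℚ ℚ.+ + m / 1               ≡⟨ cong (1ℚ ℚ.+_) (ℚ.normalize-coprime (Coprimality.sym (Coprimality.1-coprimeTo m))) ⟩
  (+ 1 ℤ.+ + m ℤ.* + 1) / 1    ≡⟨ cong (λ x → (+ 1 ℤ.+ x) / 1) (ℤ.*-identityʳ (+ m)) ⟩
  + suc m / 1                  ∎)) refl
  where open ≡-Reasoning

ofℕ≡×1# : ∀ m → ofℕ m ≡ m Mult.× 1#
ofℕ≡×1# zero    = refl
ofℕ≡×1# (suc m) = trans (ofℕ-suc m) (cong (1# ⊕_) (ofℕ≡×1# m))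

ofℕ-* : ∀ a b → ofℕ (a ℕ.* b) ≡ ofℕ a ⊗ ofℕ b
ofℕ-* a b = begin
  ofℕ (a ℕ.* b)                 ≡⟨ ofℕ≡×1# (a ℕ.* b) ⟩
  (a ℕ.* b) Mult.× 1#           ≡⟨ Mult.×1-homo-* a b ⟩
  (a Mult.× 1#) ⊗ (b Mult.× 1#)  ≡⟨ cong₂ _⊗_ (ofℕ≡×1# a) (ofℕ≡×1# b) ⟨
  ofℕ a ⊗ ofℕ b                 ∎
  where open ≡-Reasoning

ofℕ-^ : ∀ b m → ofℕ (b ℕ.^ m) ≡ ofℕ b ↑ m
ofℕ-^ b zero    = refl
ofℕ-^ b (suc m) = trans (ofℕ-* b (b ℕ.^ m)) (cong (ofℕ b ⊗_) (ofℕ-^ b m))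

ofℕ-injective : ∀ {a b} → ofℕ a ≡ ofℕ b → a ≡ b
ofℕ-injective {a} {b} eq with ℚ./-injective-≃ (mkℚᵘ (+ a) 0) (mkℚᵘ (+ b) 0) (cong re eq)
... | *≡* a*1≡b*1 = ℤ.+-injective (trans (sym (ℤ.*-identityʳ (+ a))) (trans a*1≡b*1 (ℤ.*-identityʳ (+ b))))

ofℕ-length-filter : ∀ {A : Set} {P : A → Set} (P? : U.Decidable P) xs →
  ofℕ (length (filter P? xs)) ≡ ∑ˡ xs (λ x → ⟦ does (P? x) ⟧)
ofℕ-length-filter P? []       = refl
ofℕ-length-filter P? (x ∷ xs) with does (P? x)
... | true  = trans (ofℕ-suc (length (filter P? xs))) (cong (1# ⊕_) (ofℕ-length-filter P? xs))
... | false = trans (ofℕ-length-filter P? xs) (sym (⊕-identityˡ _))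

ofℕ-ρ : ∀ k r n .{{_ : NonZero n}} → ofℕ (ρ k (+ r) n) ≡ count n k (r % n)
ofℕ-ρ k r n = ofℕ-length-filter _ (allVecs n k)

√2^≡√2↑ : ∀ m → √2^ m ≡ √2 ↑ m
√2^≡√2↑ zero    = refl
√2^≡√2↑ (suc m) = cong (√2 ⊗_) (√2^≡√2↑ m)

√2↑-* : ∀ a m → √2 ↑ (a ℕ.* m) ≡ (√2 ↑ m) ↑ a
√2↑-* a m = trans (cong (√2 ↑_) (ℕ.*-comm a m)) (sym (^-assocʳ √2 m a))

ofℕ-^-√2 : ∀ {b} a → ofℕ b ≡ √2 ↑ a → ∀ m → ofℕ (b ℕ.^ m) ≡ (√2 ↑ m) ↑ a
ofℕ-^-√2 {b} a b≡√2↑a m = begin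
  ofℕ (b ℕ.^ m)      ≡⟨ ofℕ-^ b m ⟩
  ofℕ b ↑ m          ≡⟨ cong (_↑ m) b≡√2↑a ⟩
  (√2 ↑ a) ↑ m       ≡⟨ ^-assocʳ √2 a m ⟩
  √2 ↑ (a ℕ.* m)     ≡⟨ √2↑-* a m ⟩
  (√2 ↑ m) ↑ a       ∎
  where open ≡-Reasoning

ofℕ-2^ : ∀ m → ofℕ (2 ℕ.^ m) ≡ (√2 ↑ m) ↑ 2
ofℕ-2^ = ofℕ-^-√2 2 refl

ofℕ-4^ : ∀ m → ofℕ (4 ℕ.^ m) ≡ (√2 ↑ m) ↑ 4
ofℕ-4^ = ofℕ-^-√2 4 refl

π/4-shift : ∀ (f g : ℕ → Q√2) a →
  {True (all? {n = 8} λ j → f ((a ℕ.+ toℕ j) % 8) ≟ g (toℕ j))} →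
  ∀ m → f ((a ℕ.+ m) % 8) ≡ g (m % 8)
π/4-shift f g a {table} m = begin
  f ((a ℕ.+ m) % 8)              ≡⟨ cong f (%-cong-+ˡ a (toℕ-mod-% m 8)) ⟨
  f ((a ℕ.+ toℕ (m mod 8)) % 8)  ≡⟨ toWitness table (m mod 8) ⟩
  g (toℕ (m mod 8))              ≡⟨ cong g (toℕ-mod m 8) ⟩
  g (m % 8)                      ∎
  where open ≡-Reasoning

cosπ/4[2+m]≡-sinπ/4[m] : ∀ m → cosπ/4 (2 ℕ.+ m) ≡ neg (sinπ/4 m)
cosπ/4[2+m]≡-sinπ/4[m] = π/4-shift cosTable (neg ∘ sinTable) 2

cosπ/4[4+m]≡-cosπ/4[m] : ∀ m → cosπ/4 (4 ℕ.+ m) ≡ neg (cosπ/4 m)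
cosπ/4[4+m]≡-cosπ/4[m] = π/4-shift cosTable (neg ∘ cosTable) 4

cosπ/4[6+m]≡sinπ/4[m] : ∀ m → cosπ/4 (6 ℕ.+ m) ≡ sinπ/4 m
cosπ/4[6+m]≡sinπ/4[m] = π/4-shift cosTable sinTable 6

-- The base case k = 1 and the induction step for each residue of k mod 8 are decided by
-- evaluation, through the two implicit True arguments.
count≡periodicPoly : ∀ n .{{_ : NonZero n}} D (c : ℕ → ℕ → ℕ → Q√2) →
  (∀ {k k′} → k % 8 ≡ k′ % 8 → ∀ r d → c k r d ≡ c k′ r d) →
  {True (all? {n = n} λ r → count n 1 (toℕ r) ≟ poly D (c 1 (toℕ r)) (√2 ↑ 1))} →
  {True (all? {n = 8} λ j → all? {n = n} λ r → all? {n = D} λ d →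
     addSquare n (λ t → c (toℕ j) t (toℕ d)) (toℕ r) ≟ c (suc (toℕ j)) (toℕ r) (toℕ d) ⊗ √2 ↑ toℕ d)} →
  ∀ k (r : Fin n) → count n (suc k) (toℕ r) ≡ poly D (c (suc k) (toℕ r)) (√2 ↑ suc k)
count≡periodicPoly n D c periodic {base} {step} =
  count≈closedForm n (λ k r → poly D (c k r) (√2 ↑ k)) (toWitness base)
    (λ k r → addSquare-poly-step n c √2 k (toℕ r) (stepₖ k r))
  where
  stepₖ : ∀ k (r : Fin n) (d : Fin D) →
    addSquare n (λ t → c k t (toℕ d)) (toℕ r) ≡ c (suc k) (toℕ r) (toℕ d) ⊗ √2 ↑ toℕ d
  stepₖ k r d = begin
    addSquare n (λ t → c k t (toℕ d)) (toℕ r)  ≡⟨ addSquare-cong n {λ t → c k t (toℕ d)} {λ t → c j t (toℕ d)}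
                                                    (λ t → periodic {k} {j} k≡j (toℕ t) (toℕ d)) (toℕ r) ⟩
    addSquare n (λ t → c j t (toℕ d)) (toℕ r)  ≡⟨ toWitness step (k mod 8) r d ⟩
    c (suc j) (toℕ r) (toℕ d) ⊗ √2 ↑ toℕ d      ≡⟨ cong (_⊗ √2 ↑ toℕ d)
                                                    (periodic {suc j} {suc k} (%-cong-+ˡ 1 {j} {k} (sym k≡j)) (toℕ r) (toℕ d)) ⟩
    c (suc k) (toℕ r) (toℕ d) ⊗ √2 ↑ toℕ d      ∎
    where
    open ≡-Reasoning
    j = toℕ (k mod 8)
    k≡j : k % 8 ≡ j % 8
    k≡j = sym (toℕ-mod-% k 8)

coeffs₂ : ℕ → Q√2
coeffs₂ 2 = ofℚ ½
coeffs₂ _ = 0#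

coeffs₄ : Q√2 → ℕ → Q√2
coeffs₄ B 3 = ofℚ ½ ⊗ B
coeffs₄ B 4 = ofℚ (+ 1 / 4)
coeffs₄ B _ = 0#

coeffs₈ : Q√2 → Q√2 → ℕ → Q√2
coeffs₈ B A 4 = ofℚ (+ 1 / 4) ⊗ A
coeffs₈ B A 5 = ofℚ (+ 1 / 4) ⊗ B
coeffs₈ B A 6 = ofℚ (+ 1 / 8)
coeffs₈ B A _ = 0#

-- With x = √2^k, c₄ and c₈ encode  count 4 k r = x⁴/4 + x³/2 · cos(π(k-2r)/4)  and
-- count 8 k r = x⁶/8 + x⁵/4 · cos(π(k-2r)/4) + x⁴/4 · (cos(π(k-r)/4) + cos(3π(k-r)/4));
-- the arguments are written 6r + k, 7r + k, 5r + 3k to avoid truncated subtraction.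
c₄ : ℕ → ℕ → ℕ → Q√2
c₄ k r = coeffs₄ (cosπ/4 (6 ℕ.* r ℕ.+ k))

c₈ : ℕ → ℕ → ℕ → Q√2
c₈ k r = coeffs₈ (cosπ/4 (6 ℕ.* r ℕ.+ k)) (cosπ/4 (7 ℕ.* r ℕ.+ k) ⊕ cosπ/4 (5 ℕ.* r ℕ.+ 3 ℕ.* k))

c₄-periodic : ∀ {k k′} → k % 8 ≡ k′ % 8 → ∀ r d → c₄ k r d ≡ c₄ k′ r d
c₄-periodic k≡k′ r d = cong (λ B → coeffs₄ B d) (cong cosTable (%-cong-+ˡ (6 ℕ.* r) k≡k′))

c₈-periodic : ∀ {k k′} → k % 8 ≡ k′ % 8 → ∀ r d → c₈ k r d ≡ c₈ k′ r d
c₈-periodic {k} {k′} k≡k′ r d = cong₂ (λ B A → coeffs₈ B A d)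
  (cong cosTable (%-cong-+ˡ (6 ℕ.* r) k≡k′))
  (cong₂ _⊕_ (cong cosTable (%-cong-+ˡ (7 ℕ.* r) k≡k′))
             (cong cosTable (%-cong-+ˡ (5 ℕ.* r) (%-cong-*ˡ 3 {k} {k′} k≡k′))))

count₂ : ∀ k (r : Fin 2) → count 2 (suc k) (toℕ r) ≡ poly 3 coeffs₂ (√2 ↑ suc k)
count₂ = count≡periodicPoly 2 3 (λ _ _ → coeffs₂) (λ _ _ _ → refl)

count₄ : ∀ k (r : Fin 4) → count 4 (suc k) (toℕ r) ≡ poly 5 (c₄ (suc k) (toℕ r)) (√2 ↑ suc k)
count₄ = count≡periodicPoly 4 5 c₄ c₄-periodic

count₈ : ∀ k (r : Fin 8) → count 8 (suc k) (toℕ r) ≡ poly 7 (c₈ (suc k) (toℕ r)) (√2 ↑ suc k)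
count₈ = count≡periodicPoly 8 7 c₈ c₈-periodic

poly-coeffs₂ : ∀ y → poly 3 coeffs₂ (√2 ⊗ y) ≡ y ↑ 2
poly-coeffs₂ = solve 1 (λ y →
    con 0# :* (con √2 :* y) :^ 0 :+ (con 0# :* (con √2 :* y) :^ 1
    :+ (con (ofℚ ½) :* (con √2 :* y) :^ 2 :+ con 0#))
  := y :^ 2) refl

-- The closed forms in the variables of the statement: Q = 4^(k-1) and T = 2^(3k/2) for n = 4;
-- P₄ = 4^k, P₂ = 2^k and X = 2^(k/2) for n = 8.
N₄ : (Q T B : Q√2) → Q√2
N₄ Q T B = Q ⊕ T ⊗ ofℚ ½ ⊗ B

N₈ : (P₄ P₂ X B A₁ A₂ : Q√2) → Q√2
N₈ P₄ P₂ X B A₁ A₂ = ofℚ (+ 1 / 8) ⊗ P₄ ⊗ P₂ ⊕ ofℚ (+ 1 / 4) ⊗ B ⊗ P₄ ⊗ X ⊕ ofℚ (+ 1 / 4) ⊗ (A₁ ⊕ A₂) ⊗ P₄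

poly-coeffs₄ : ∀ B y → poly 5 (coeffs₄ B) (√2 ⊗ y) ≡ N₄ (y ↑ 4) ((√2 ⊗ y) ↑ 3) B
poly-coeffs₄ = solve 2 (λ B y →
    con 0# :* (con √2 :* y) :^ 0 :+ (con 0# :* (con √2 :* y) :^ 1 :+ (con 0# :* (con √2 :* y) :^ 2
    :+ (con (ofℚ ½) :* B :* (con √2 :* y) :^ 3 :+ (con (ofℚ (+ 1 / 4)) :* (con √2 :* y) :^ 4 :+ con 0#))))
  := y :^ 4 :+ (con √2 :* y) :^ 3 :* con (ofℚ ½) :* B) refl

poly-coeffs₈ : ∀ B A₁ A₂ x → poly 7 (coeffs₈ B (A₁ ⊕ A₂)) x ≡ N₈ (x ↑ 4) (x ↑ 2) x B A₁ A₂
poly-coeffs₈ = solve 4 (λ B A₁ A₂ x →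
    con 0# :* x :^ 0 :+ (con 0# :* x :^ 1 :+ (con 0# :* x :^ 2 :+ (con 0# :* x :^ 3 :+
    (con (ofℚ (+ 1 / 4)) :* (A₁ :+ A₂) :* x :^ 4 :+ (con (ofℚ (+ 1 / 4)) :* B :* x :^ 5 :+
    (con (ofℚ (+ 1 / 8)) :* x :^ 6 :+ con 0#))))))
  := con (ofℚ (+ 1 / 8)) :* x :^ 4 :* x :^ 2 :+ con (ofℚ (+ 1 / 4)) :* B :* x :^ 4 :* x
     :+ con (ofℚ (+ 1 / 4)) :* (A₁ :+ A₂) :* x :^ 4) refl

ofℕ-ρ₄ : ∀ k (r : Fin 4) → ofℕ (ρ (suc k) (+ toℕ r) 4) ≡
  N₄ (ofℕ (4 ℕ.^ k)) (√2^ (3 ℕ.* suc k)) (cosπ/4 (6 ℕ.* toℕ r ℕ.+ suc k))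
ofℕ-ρ₄ k r = begin
  ofℕ (ρ (suc k) (+ toℕ r) 4)               ≡⟨ ofℕ-ρ (suc k) (toℕ r) 4 ⟩
  count 4 (suc k) (toℕ r % 4)               ≡⟨ cong (count 4 (suc k)) (m<n⇒m%n≡m (toℕ<n r)) ⟩
  count 4 (suc k) (toℕ r)                   ≡⟨ count₄ k r ⟩
  poly 5 (c₄ (suc k) (toℕ r)) (√2 ⊗ y)      ≡⟨ poly-coeffs₄ B y ⟩
  N₄ (y ↑ 4) ((√2 ⊗ y) ↑ 3) B               ≡⟨ cong₂ (λ Q T → N₄ Q T B) (sym (ofℕ-4^ k))
                                                 (sym (trans (√2^≡√2↑ (3 ℕ.* suc k)) (√2↑-* 3 (suc k)))) ⟩
  N₄ (ofℕ (4 ℕ.^ k)) (√2^ (3 ℕ.* suc k)) B  ∎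
  where
  open ≡-Reasoning
  y = √2 ↑ k
  B = cosπ/4 (6 ℕ.* toℕ r ℕ.+ suc k)

ofℕ-ρ₈ : ∀ k (r : Fin 8) → ofℕ (ρ (suc k) (+ toℕ r) 8) ≡
  N₈ (ofℕ (4 ℕ.^ suc k)) (ofℕ (2 ℕ.^ suc k)) (√2^ (suc k)) (cosπ/4 (6 ℕ.* toℕ r ℕ.+ suc k))
     (cosπ/4 (7 ℕ.* toℕ r ℕ.+ suc k)) (cosπ/4 (5 ℕ.* toℕ r ℕ.+ 3 ℕ.* suc k))
ofℕ-ρ₈ k r = begin
  ofℕ (ρ (suc k) (+ toℕ r) 8)               ≡⟨ ofℕ-ρ (suc k) (toℕ r) 8 ⟩
  count 8 (suc k) (toℕ r % 8)               ≡⟨ cong (count 8 (suc k)) (m<n⇒m%n≡m (toℕ<n r)) ⟩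
  count 8 (suc k) (toℕ r)                   ≡⟨ count₈ k r ⟩
  poly 7 (c₈ (suc k) (toℕ r)) x             ≡⟨ poly-coeffs₈ B A₁ A₂ x ⟩
  N₈ (x ↑ 4) (x ↑ 2) x B A₁ A₂              ≡⟨ cong₃ (λ P₄ P₂ X → N₈ P₄ P₂ X B A₁ A₂)
                                                 (sym (ofℕ-4^ (suc k))) (sym (ofℕ-2^ (suc k))) (sym (√2^≡√2↑ (suc k))) ⟩
  N₈ (ofℕ (4 ℕ.^ suc k)) (ofℕ (2 ℕ.^ suc k)) (√2^ (suc k)) B A₁ A₂ ∎
  where
  open ≡-Reasoning
  x  = √2 ↑ suc k
  B  = cosπ/4 (6 ℕ.* toℕ r ℕ.+ suc k)
  A₁ = cosπ/4 (7 ℕ.* toℕ r ℕ.+ suc k)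
  A₂ = cosπ/4 (5 ℕ.* toℕ r ℕ.+ 3 ℕ.* suc k)

open import Data.Nat using (_≤_; _^_; _∸_; _+_; _*_)

ρ-1-2 : ∀ k → 1 ≤ k → ρ k (+ 1) 2 ≡ 2 ^ (k ∸ 1)
ρ-1-2 (suc k) _ = ofℕ-injective (begin
  ofℕ (ρ (suc k) (+ 1) 2)   ≡⟨ ofℕ-ρ (suc k) 1 2 ⟩
  count 2 (suc k) 1         ≡⟨ count₂ k (# 1) ⟩
  poly 3 coeffs₂ (√2 ⊗ y)   ≡⟨ poly-coeffs₂ y ⟩
  y ↑ 2                     ≡⟨ ofℕ-2^ k ⟨
  ofℕ (2 ^ k)               ∎)
  where
  open ≡-Reasoning
  y = √2 ↑ k

ρ-1-4 : ∀ k → 1 ≤ k → ofℕ (ρ k (+ 1) 4) ≡ ofℕ (4 ^ (k ∸ 1)) ⊕ √2^ (3 * k) ⊗ ofℚ ½ ⊗ sinπ/4 k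
ρ-1-4 (suc k) _ =
  trans (ofℕ-ρ₄ k (# 1)) (cong (N₄ (ofℕ (4 ^ k)) (√2^ (3 * suc k))) (cosπ/4[6+m]≡sinπ/4[m] (suc k)))

ρ-3-4 : ∀ k → 1 ≤ k → ofℕ (ρ k (+ 3) 4) ≡ ofℕ (4 ^ (k ∸ 1)) ⊖ √2^ (3 * k) ⊗ ofℚ ½ ⊗ sinπ/4 k
ρ-3-4 (suc k) _ = begin
  ofℕ (ρ (suc k) (+ 3) 4)                ≡⟨ ofℕ-ρ₄ k (# 3) ⟩
  Q ⊕ T ⊗ ofℚ ½ ⊗ cosπ/4 (2 + suc k)     ≡⟨ cong (λ c → Q ⊕ T ⊗ ofℚ ½ ⊗ c) (cosπ/4[2+m]≡-sinπ/4[m] (suc k)) ⟩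
  Q ⊕ T ⊗ ofℚ ½ ⊗ neg s                  ≡⟨ cong (Q ⊕_) (-‿distribʳ-* (T ⊗ ofℚ ½) s) ⟨
  Q ⊖ T ⊗ ofℚ ½ ⊗ s                      ∎
  where
  open ≡-Reasoning
  Q = ofℕ (4 ^ k)
  T = √2^ (3 * suc k)
  s = sinπ/4 (suc k)

ρ-1-8 : ∀ k → 1 ≤ k → ofℕ (ρ k (+ 1) 8) ≡ ofℚ (+ 1 / 8) ⊗ ofℕ (4 ^ k)
         ⊗ (ofℕ (2 ^ k) ⊕ √2^ k ⊗ ofℕ 2 ⊗ sinπ/4 k
            ⊕ ofℕ 2 ⊗ sinπ/4 (k + 1) ⊖ ofℕ 2 ⊗ cosπ/4 (3 * k + 1))
ρ-1-8 (suc k) _ = begin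
  ofℕ (ρ K (+ 1) 8)
    ≡⟨ ofℕ-ρ₈ k (# 1) ⟩
  N₈ P₄ P₂ X (cosπ/4 (6 + K)) (cosπ/4 (6 + suc K)) (cosπ/4 (4 + (1 + 3 * K)))
    ≡⟨ cong₃ (N₈ P₄ P₂ X) (cosπ/4[6+m]≡sinπ/4[m] K)
         (trans (cosπ/4[6+m]≡sinπ/4[m] (suc K)) (cong sinπ/4 (ℕ.+-comm 1 K)))
         (trans (cosπ/4[4+m]≡-cosπ/4[m] (1 + 3 * K)) (cong (neg ∘ cosπ/4) (ℕ.+-comm 1 (3 * K)))) ⟩
  N₈ P₄ P₂ X s₀ s₁ (neg c₃)
    ≡⟨ solve 6 (λ P₄ P₂ X s₀ s₁ c₃ →
         con (ofℚ (+ 1 / 8)) :* P₄ :* P₂ :+ con (ofℚ (+ 1 / 4)) :* s₀ :* P₄ :* X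
           :+ con (ofℚ (+ 1 / 4)) :* (s₁ :+ :- c₃) :* P₄
       := con (ofℚ (+ 1 / 8)) :* P₄ :* (P₂ :+ X :* con (ofℕ 2) :* s₀
           :+ con (ofℕ 2) :* s₁ :- con (ofℕ 2) :* c₃)) refl P₄ P₂ X s₀ s₁ c₃ ⟩
  ofℚ (+ 1 / 8) ⊗ P₄ ⊗ (P₂ ⊕ X ⊗ ofℕ 2 ⊗ s₀ ⊕ ofℕ 2 ⊗ s₁ ⊖ ofℕ 2 ⊗ c₃) ∎
  where
  open ≡-Reasoning
  K = suc k
  P₄ = ofℕ (4 ^ K)
  P₂ = ofℕ (2 ^ K)
  X = √2^ K
  s₀ = sinπ/4 K
  s₁ = sinπ/4 (K + 1)
  c₃ = cosπ/4 (3 * K + 1)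

ρ-3-8 : ∀ k → 1 ≤ k → ofℕ (ρ k (+ 3) 8) ≡ ofℚ (+ 1 / 8) ⊗ ofℕ (4 ^ k)
         ⊗ (ofℕ (2 ^ k) ⊖ √2^ k ⊗ ofℕ 2 ⊗ sinπ/4 k
            ⊖ ofℕ 2 ⊗ (cosπ/4 (k + 1) ⊕ cosπ/4 (3 * (k + 1))))
ρ-3-8 (suc k) _ = begin
  ofℕ (ρ K (+ 3) 8)
    ≡⟨ ofℕ-ρ₈ k (# 3) ⟩
  N₈ P₄ P₂ X (cosπ/4 (2 + K)) (cosπ/4 (4 + suc K)) (cosπ/4 (4 + (3 + 3 * K)))
    ≡⟨ cong₃ (N₈ P₄ P₂ X) (cosπ/4[2+m]≡-sinπ/4[m] K)
         (trans (cosπ/4[4+m]≡-cosπ/4[m] (suc K)) (cong (neg ∘ cosπ/4) (ℕ.+-comm 1 K)))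
         (trans (cosπ/4[4+m]≡-cosπ/4[m] (3 + 3 * K))
                (cong (neg ∘ cosπ/4) (trans (sym (ℕ.*-suc 3 K)) (cong (3 *_) (ℕ.+-comm 1 K))))) ⟩
  N₈ P₄ P₂ X (neg s₀) (neg c₁) (neg c₃)
    ≡⟨ solve 6 (λ P₄ P₂ X s₀ c₁ c₃ →
         con (ofℚ (+ 1 / 8)) :* P₄ :* P₂ :+ con (ofℚ (+ 1 / 4)) :* (:- s₀) :* P₄ :* X
           :+ con (ofℚ (+ 1 / 4)) :* (:- c₁ :+ :- c₃) :* P₄
       := con (ofℚ (+ 1 / 8)) :* P₄ :* (P₂ :- X :* con (ofℕ 2) :* s₀
           :- con (ofℕ 2) :* (c₁ :+ c₃))) refl P₄ P₂ X s₀ c₁ c₃ ⟩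
  ofℚ (+ 1 / 8) ⊗ P₄ ⊗ (P₂ ⊖ X ⊗ ofℕ 2 ⊗ s₀ ⊖ ofℕ 2 ⊗ (c₁ ⊕ c₃)) ∎
  where
  open ≡-Reasoning
  K = suc k
  P₄ = ofℕ (4 ^ K)
  P₂ = ofℕ (2 ^ K)
  X = √2^ K
  s₀ = sinπ/4 K
  c₁ = cosπ/4 (K + 1)
  c₃ = cosπ/4 (3 * (K + 1))

ρ-5-8 : ∀ k → 1 ≤ k → ofℕ (ρ k (+ 5) 8) ≡ ofℚ (+ 1 / 8) ⊗ ofℕ (4 ^ k)
         ⊗ (ofℕ (2 ^ k) ⊕ √2^ k ⊗ ofℕ 2 ⊗ sinπ/4 k
            ⊖ ofℕ 2 ⊗ sinπ/4 (k + 1) ⊕ ofℕ 2 ⊗ cosπ/4 (3 * k + 1))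
ρ-5-8 (suc k) _ = begin
  ofℕ (ρ K (+ 5) 8)
    ≡⟨ ofℕ-ρ₈ k (# 5) ⟩
  N₈ P₄ P₂ X (cosπ/4 (6 + K)) (cosπ/4 (2 + suc K)) (cosπ/4 (1 + 3 * K))
    ≡⟨ cong₃ (N₈ P₄ P₂ X) (cosπ/4[6+m]≡sinπ/4[m] K)
         (trans (cosπ/4[2+m]≡-sinπ/4[m] (suc K)) (cong (neg ∘ sinπ/4) (ℕ.+-comm 1 K)))
         (cong cosπ/4 (ℕ.+-comm 1 (3 * K))) ⟩
  N₈ P₄ P₂ X s₀ (neg s₁) c₃
    ≡⟨ solve 6 (λ P₄ P₂ X s₀ s₁ c₃ →
         con (ofℚ (+ 1 / 8)) :* P₄ :* P₂ :+ con (ofℚ (+ 1 / 4)) :* s₀ :* P₄ :* X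
           :+ con (ofℚ (+ 1 / 4)) :* (:- s₁ :+ c₃) :* P₄
       := con (ofℚ (+ 1 / 8)) :* P₄ :* (P₂ :+ X :* con (ofℕ 2) :* s₀
           :- con (ofℕ 2) :* s₁ :+ con (ofℕ 2) :* c₃)) refl P₄ P₂ X s₀ s₁ c₃ ⟩
  ofℚ (+ 1 / 8) ⊗ P₄ ⊗ (P₂ ⊕ X ⊗ ofℕ 2 ⊗ s₀ ⊖ ofℕ 2 ⊗ s₁ ⊕ ofℕ 2 ⊗ c₃) ∎
  where
  open ≡-Reasoning
  K = suc k
  P₄ = ofℕ (4 ^ K)
  P₂ = ofℕ (2 ^ K)
  X = √2^ K
  s₀ = sinπ/4 K
  s₁ = sinπ/4 (K + 1)
  c₃ = cosπ/4 (3 * K + 1)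

ρ-7-8 : ∀ k → 1 ≤ k → ofℕ (ρ k (+ 7) 8) ≡ ofℚ (+ 1 / 8) ⊗ ofℕ (4 ^ k)
         ⊗ (ofℕ (2 ^ k) ⊖ √2^ k ⊗ ofℕ 2 ⊗ sinπ/4 k
            ⊖ ofℕ 2 ⊗ sinπ/4 (3 * k + 1) ⊕ ofℕ 2 ⊗ cosπ/4 (k + 1))
ρ-7-8 (suc k) _ = begin
  ofℕ (ρ K (+ 7) 8)
    ≡⟨ ofℕ-ρ₈ k (# 7) ⟩
  N₈ P₄ P₂ X (cosπ/4 (2 + K)) (cosπ/4 (suc K)) (cosπ/4 (2 + (1 + 3 * K)))
    ≡⟨ cong₃ (N₈ P₄ P₂ X) (cosπ/4[2+m]≡-sinπ/4[m] K)
         (cong cosπ/4 (ℕ.+-comm 1 K))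
         (trans (cosπ/4[2+m]≡-sinπ/4[m] (1 + 3 * K)) (cong (neg ∘ sinπ/4) (ℕ.+-comm 1 (3 * K)))) ⟩
  N₈ P₄ P₂ X (neg s₀) c₁ (neg s₃)
    ≡⟨ solve 6 (λ P₄ P₂ X s₀ c₁ s₃ →
         con (ofℚ (+ 1 / 8)) :* P₄ :* P₂ :+ con (ofℚ (+ 1 / 4)) :* (:- s₀) :* P₄ :* X
           :+ con (ofℚ (+ 1 / 4)) :* (c₁ :+ :- s₃) :* P₄
       := con (ofℚ (+ 1 / 8)) :* P₄ :* (P₂ :- X :* con (ofℕ 2) :* s₀
           :- con (ofℕ 2) :* s₃ :+ con (ofℕ 2) :* c₁)) refl P₄ P₂ X s₀ c₁ s₃ ⟩
  ofℚ (+ 1 / 8) ⊗ P₄ ⊗ (P₂ ⊖ X ⊗ ofℕ 2 ⊗ s₀ ⊖ ofℕ 2 ⊗ s₃ ⊕ ofℕ 2 ⊗ c₁) ∎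
  where
  open ≡-Reasoning
  K = suc k
  P₄ = ofℕ (4 ^ K)
  P₂ = ofℕ (2 ^ K)
  X = √2^ K
  s₀ = sinπ/4 K
  c₁ = cosπ/4 (K + 1)
  s₃ = sinπ/4 (3 * K + 1)

-- 2^(3k/2 - 1) = (√2)^(3k) · ½ ;  2^(k/2 + 1) = (√2)^k · 2 ;  2^(2k-3) = (1/8) · 4^k
lemma4 : (k : ℕ) → 1 ≤ k →
  (ρ k (+ 1) 2 ≡ 2 ^ (k ∸ 1))
  × (ofℕ (ρ k (+ 1) 4) ≡ ofℕ (4 ^ (k ∸ 1)) ⊕ √2^ (3 * k) ⊗ ofℚ ½ ⊗ sinπ/4 k)
  × (ofℕ (ρ k (+ 3) 4) ≡ ofℕ (4 ^ (k ∸ 1)) ⊖ √2^ (3 * k) ⊗ ofℚ ½ ⊗ sinπ/4 k)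
  × (ofℕ (ρ k (+ 1) 8) ≡ ofℚ (+ 1 / 8) ⊗ ofℕ (4 ^ k)
       ⊗ (ofℕ (2 ^ k) ⊕ √2^ k ⊗ ofℕ 2 ⊗ sinπ/4 k
          ⊕ ofℕ 2 ⊗ sinπ/4 (k + 1) ⊖ ofℕ 2 ⊗ cosπ/4 (3 * k + 1)))
  × (ofℕ (ρ k (+ 3) 8) ≡ ofℚ (+ 1 / 8) ⊗ ofℕ (4 ^ k)
       ⊗ (ofℕ (2 ^ k) ⊖ √2^ k ⊗ ofℕ 2 ⊗ sinπ/4 k
          ⊖ ofℕ 2 ⊗ (cosπ/4 (k + 1) ⊕ cosπ/4 (3 * (k + 1)))))
  × (ofℕ (ρ k (+ 5) 8) ≡ ofℚ (+ 1 / 8) ⊗ ofℕ (4 ^ k)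
       ⊗ (ofℕ (2 ^ k) ⊕ √2^ k ⊗ ofℕ 2 ⊗ sinπ/4 k
          ⊖ ofℕ 2 ⊗ sinπ/4 (k + 1) ⊕ ofℕ 2 ⊗ cosπ/4 (3 * k + 1)))
  × (ofℕ (ρ k (+ 7) 8) ≡ ofℚ (+ 1 / 8) ⊗ ofℕ (4 ^ k)
       ⊗ (ofℕ (2 ^ k) ⊖ √2^ k ⊗ ofℕ 2 ⊗ sinπ/4 k
          ⊖ ofℕ 2 ⊗ sinπ/4 (3 * k + 1) ⊕ ofℕ 2 ⊗ cosπ/4 (k + 1)))
lemma4 k 1≤k =
  ρ-1-2 k 1≤k , ρ-1-4 k 1≤k , ρ-3-4 k 1≤k , ρ-1-8 k 1≤k , ρ-3-8 k 1≤k , ρ-5-8 k 1≤k , ρ-7-8 k 1≤k
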